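{- In $\mathrm{LK}(\mathcal T)$, for every context $\Gamma$, every positive literal $p$, every formula $B$ and every multiset of formulae $\Delta$, assume $\mathcal T(\Gamma^{lit},\overline p)$ holds. Then: (cut_1) if $\Gamma,p\vdash\Delta$ is derivable, then $\Gamma\vdash\Delta$ is derivable; (cut_2) if $\Gamma,p\vdash[B]$ is derivable, then $\Gamma\vdash[B]$ is derivable.
   Context: Work in first-order logic where every predicate symbol is classified as either positive or negative. A literal is an atom (a predicate symbol applied to a list of first-order terms) or the negation of an atom; literals carry the involutive negation $l \mapsto \overline{l}$. Let $\mathcal P$ be the set of literals that are either atoms with a positive predicate symbol or negations of atoms with a negative predicate symbol; elements of $\mathcal P$ are called positive literals. Formulae are: positive formulae $P ::= p \mid A \wedge^+ B \mid A \vee^+ B \mid \exists x A$ and negative formulae $N ::= \overline{p} \mid A \wedge^- B \mid A \vee^- B \mid \forall x A$, with $p \in \mathcal P$ and $A,B$ arbitrary formulae. Negation is extended to all formulae by $\overline{\overline p}=p$, $\overline{A\wedge^+B}=\overline A\vee^-\overline B$, $\overline{A\wedge^-B}=\overline A\vee^+\overline B$, $\overline{A\vee^+B}=\overline A\wedge^-\overline B$, $\overline{A\vee^-B}=\overline A\wedge^+\overline B$, $\overline{\exists xA}=\forall x\overline A$, $\overline{\forall xA}=\exists x\overline A$. $A\{x:=t\}$ denotes capture-avoiding substitution. A procedure $\mathcal T$ is a predicate $\mathcal T(S)$ on finite sets $S$ of literals (intuitively: the decision procedure returns UNSAT on the conjunction of $S$), assumed to satisfy: (Weakening) $\mathcal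 T(S)$ implies $\mathcal T(S\cup S')$; (Contraction) $\mathcal T(S,A,A)$ implies $\mathcal T(S,A)$; (Instantiation) $\mathcal T(S)$ implies $\mathcal T(S\{x:=t\})$; (Consistency) $\mathcal T(S,p)$ and $\mathcal T(S,\overline p)$ imply $\mathcal T(S)$. The calculus $\mathrm{LK}(\mathcal T)$ has focused sequents $\Gamma\vdash[A]$ and unfocused sequents $\Gamma\vdash\Delta$, where $\Gamma$ (a context) is a multiset of negative formulae and positive literals, $\Delta$ is a multiset of formulae, and $A$ is a formula. $\Gamma^{lit}$ denotes the sub-multiset of literals of $\Gamma$. Rules (premisses above conclusion written as "from ... infer ..."): Synchronous: from $\Gamma\vdash[A]$ and $\Gamma\vdash[B]$ infer $\Gamma\vdash[A\wedge^+B]$; from $\Gamma\vdash[A_i]$ ($i\in\{1,2\}$) infer $\Gamma\vdash[A_1\vee^+A_2]$; from $\Gamma\vdash[A\{x:=t\}]$ infer $\Gamma\vdash[\exists xA]$; infer $\Gamma,p\vdash[p]$ for $p$ a positive literal (axiom); if $\mathcal T(\Gamma^{lit},\overline p)$ holds, infer $\Gamma\vdash[p]$ for $p$ a positive literal; from $\Gamma\vdash N$ infer $\Gamma\vdash[N]$ for $N$ negative. Asynchronous: from $\Gamma\vdash A,\Delta$ and $\Gamma\vdash B,\Delta$ infer $\Gamma\vdash A\wedge^-B,\Delta$; from $\Gamma\vdash A_1,A_2,\Delta$ infer $\Gamma\vdash A_1\vee^-A_2,\Delta$; from $\Gamma\vdash A,\Delta$ infer $\Gamma\vdash\forall xA,\Delta$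 provided $x$ is not free in $\Gamma,\Delta$; from $\Gamma,\overline A\vdash\Delta$ infer $\Gamma\vdash A,\Delta$ provided $A$ is positive or a literal. Structural: from $\Gamma,\overline P\vdash[P]$ infer $\Gamma,\overline P\vdash$ (empty right-hand side) for $P$ positive; if $\mathcal T(\Gamma^{lit})$ holds, infer $\Gamma\vdash$ (empty right-hand side). -}

module Defs where

open import Data.Nat using (ℕ; zero; suc)
open import Data.Nat.Properties using (_≟_)
open import Data.Fin using (Fin; zero; suc)
open import Data.Irrelevant using ([_])
open import Data.List using (List; []; _∷_; _++_; map; mapMaybe)
open import Data.List.Membership.Propositional using (_∉_)
open import Data.List.Relation.Binary.BagAndSetEquality using (_∼[_]_; set)
open import Data.List.Relation.Binary.Permutation.Propositional using (_↭_)
open import Data.List.Relation.Unary.All using (All)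
open import Data.Maybe using (Maybe; just; nothing)
open import Data.Refinement using (Refinement; value) renaming (_,_ to _,ʳ_)
open import Data.Sum using (_⊎_; inj₁; inj₂)
open import Data.Vec using (Vec; []; _∷_)
open import Function using (_∘_)
open import Relation.Binary.PropositionalEquality using (_≡_; refl; trans)
open import Relation.Nullary using (yes; no)

data Polarity : Set where
  positive negative : Polarity

opposite : Polarity → Polarity
opposite positive = negative
opposite negative = positive

record Signature : Set₁ where
  field
    FunSym    : Set
    funArity  : FunSym → ℕ
    PredSym   : Set
    predArity : PredSym → ℕ
    predPol   : PredSym → Polarity

-- Syntax is locally nameless: free variables are names, bound variables are
-- de Bruijn indices, and the index n counts the enclosing binders.  Formulae
-- up to α-equivalence are thus the elements of Formula 0.

Name : Set
Name = ℕ

module Syntax (Sig : Signature) where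
  open Signature Sig

  data Term (n : ℕ) : Set where
    bvar : Fin n → Term n
    fvar : Name → Term n
    fun  : (f : FunSym) → Vec (Term n) (funArity f) → Term n

  data Literal (n : ℕ) : Set where
    atom    : (R : PredSym) → Vec (Term n) (predArity R) → Literal n
    negAtom : (R : PredSym) → Vec (Term n) (predArity R) → Literal n

  infix 25 ~ˡ_
  ~ˡ_ : ∀ {n} → Literal n → Literal n
  ~ˡ atom R ts    = negAtom R ts
  ~ˡ negAtom R ts = atom R ts

  litPol : ∀ {n} → Literal n → Polarity
  litPol (atom R _)    = predPol R
  litPol (negAtom R _) = opposite (predPol R)

  infix 4 _∈𝒫
  _∈𝒫 : ∀ {n} → Literal n → Set
  l ∈𝒫 = litPol l ≡ positive

  -- The literals p and p̄ with p ∈ 𝒫 together are exactly all literals, so a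
  -- single constructor serves both; `polarity` recovers the two classes.
  infixr 22 _∧⁺_ _∧⁻_
  infixr 21 _∨⁺_ _∨⁻_
  data Formula (n : ℕ) : Set where
    lit       : Literal n → Formula n
    _∧⁺_ _∨⁺_ : Formula n → Formula n → Formula n
    _∧⁻_ _∨⁻_ : Formula n → Formula n → Formula n
    ∃′ ∀′     : Formula (suc n) → Formula n

  polarity : ∀ {n} → Formula n → Polarity
  polarity (lit l)  = litPol l
  polarity (_ ∧⁺ _) = positive
  polarity (_ ∨⁺ _) = positive
  polarity (∃′ _)   = positive
  polarity (_ ∧⁻ _) = negative
  polarity (_ ∨⁻ _) = negative
  polarity (∀′ _)   = negative

  Positive Negative : ∀ {n} → Formula n → Set
  Positive A = polarity A ≡ positive
  Negative A = polarity A ≡ negative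

  data IsLiteral {n : ℕ} : Formula n → Set where
    isLiteral : ∀ l → IsLiteral (lit l)

  infix 25 ~_
  ~_ : ∀ {n} → Formula n → Formula n
  ~ lit l    = lit (~ˡ l)
  ~ (A ∧⁺ B) = ~ A ∨⁻ ~ B
  ~ (A ∧⁻ B) = ~ A ∨⁺ ~ B
  ~ (A ∨⁺ B) = ~ A ∧⁻ ~ B
  ~ (A ∨⁻ B) = ~ A ∧⁺ ~ B
  ~ ∃′ A     = ∀′ (~ A)
  ~ ∀′ A     = ∃′ (~ A)

  -- Simultaneous replacement of bound indices.

  BSub : ℕ → ℕ → Set
  BSub m n = Fin m → Term n

  mutual
    bsubᵗ : ∀ {m n} → BSub m n → Term m → Term n
    bsubᵗ σ (bvar i)   = σ i
    bsubᵗ σ (fvar x)   = fvar x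
    bsubᵗ σ (fun f ts) = fun f (bsubᵗˢ σ ts)

    bsubᵗˢ : ∀ {m n k} → BSub m n → Vec (Term m) k → Vec (Term n) k
    bsubᵗˢ σ []       = []
    bsubᵗˢ σ (t ∷ ts) = bsubᵗ σ t ∷ bsubᵗˢ σ ts

  lift : ∀ {m n} → BSub m n → BSub (suc m) (suc n)
  lift σ zero    = bvar zero
  lift σ (suc i) = bsubᵗ (bvar ∘ suc) (σ i)

  bsubˡ : ∀ {m n} → BSub m n → Literal m → Literal n
  bsubˡ σ (atom R ts)    = atom R (bsubᵗˢ σ ts)
  bsubˡ σ (negAtom R ts) = negAtom R (bsubᵗˢ σ ts)

  bsub : ∀ {m n} → BSub m n → Formula m → Formula n
  bsub σ (lit l)  = lit (bsubˡ σ l)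
  bsub σ (A ∧⁺ B) = bsub σ A ∧⁺ bsub σ B
  bsub σ (A ∨⁺ B) = bsub σ A ∨⁺ bsub σ B
  bsub σ (A ∧⁻ B) = bsub σ A ∧⁻ bsub σ B
  bsub σ (A ∨⁻ B) = bsub σ A ∨⁻ bsub σ B
  bsub σ (∃′ A)   = ∃′ (bsub (lift σ) A)
  bsub σ (∀′ A)   = ∀′ (bsub (lift σ) A)

  -- A ⟨ t ⟩ is A{x:=t}, where A is the body of a quantifier binding x.
  infix 26 _⟨_⟩
  _⟨_⟩ : Formula 1 → Term 0 → Formula 0
  A ⟨ t ⟩ = bsub (λ _ → t) A

  -- Substitution {x:=t} for a free variable x.

  mutual
    substᵗ : Name → Term 0 → Term 0 → Term 0
    substᵗ x t (fvar y) with x ≟ y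
    ... | yes _ = t
    ... | no  _ = fvar y
    substᵗ x t (fun f ts) = fun f (substᵗˢ x t ts)

    substᵗˢ : ∀ {k} → Name → Term 0 → Vec (Term 0) k → Vec (Term 0) k
    substᵗˢ x t []       = []
    substᵗˢ x t (u ∷ us) = substᵗ x t u ∷ substᵗˢ x t us

  substˡ : Name → Term 0 → Literal 0 → Literal 0
  substˡ x t (atom R ts)    = atom R (substᵗˢ x t ts)
  substˡ x t (negAtom R ts) = negAtom R (substᵗˢ x t ts)

  mutual
    fvᵗ : ∀ {n} → Term n → List Name
    fvᵗ (bvar _)   = []
    fvᵗ (fvar x)   = x ∷ []
    fvᵗ (fun f ts) = fvᵗˢ ts

    fvᵗˢ : ∀ {n k} → Vec (Term n) k → List Name
    fvᵗˢ []       = []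
    fvᵗˢ (t ∷ ts) = fvᵗ t ++ fvᵗˢ ts

  fvˡ : ∀ {n} → Literal n → List Name
  fvˡ (atom R ts)    = fvᵗˢ ts
  fvˡ (negAtom R ts) = fvᵗˢ ts

  fv : ∀ {n} → Formula n → List Name
  fv (lit l)  = fvˡ l
  fv (A ∧⁺ B) = fv A ++ fv B
  fv (A ∨⁺ B) = fv A ++ fv B
  fv (A ∧⁻ B) = fv A ++ fv B
  fv (A ∨⁻ B) = fv A ++ fv B
  fv (∃′ A)   = fv A
  fv (∀′ A)   = fv A

  data IsContextFormula : Formula 0 → Set where
    negativeFormula : ∀ {N} → Negative N → IsContextFormula N
    positiveLiteral : ∀ {p} → p ∈𝒫 → IsContextFormula (lit p)

  ContextFormula : Set
  ContextFormula = Refinement (Formula 0) IsContextFormula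

  -- Lists stand for multisets; see the exchange rules of LK.
  Context : Set
  Context = List ContextFormula

  asLiteral : Formula 0 → Maybe (Literal 0)
  asLiteral (lit l) = just l
  asLiteral _       = nothing

  infix 27 _ˡⁱᵗ
  _ˡⁱᵗ : Context → List (Literal 0)
  Γ ˡⁱᵗ = mapMaybe (asLiteral ∘ value) Γ

  opp-positive : ∀ {π} → π ≡ positive → opposite π ≡ negative
  opp-positive refl = refl

  ~ˡ-pol : ∀ {n} (l : Literal n) → litPol (~ˡ l) ≡ opposite (litPol l)
  ~ˡ-pol (atom R _) = refl
  ~ˡ-pol (negAtom R _) with predPol R
  ... | positive = refl
  ... | negative = refl

  ~-pol : ∀ {n} (A : Formula n) → polarity (~ A) ≡ opposite (polarity A)
  ~-pol (lit l)  = ~ˡ-pol l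
  ~-pol (_ ∧⁺ _) = refl
  ~-pol (_ ∨⁺ _) = refl
  ~-pol (_ ∧⁻ _) = refl
  ~-pol (_ ∨⁻ _) = refl
  ~-pol (∃′ _)   = refl
  ~-pol (∀′ _)   = refl

  litIsContext : ∀ l → IsContextFormula (lit l)
  litIsContext l with litPol l in eq
  ... | positive = positiveLiteral eq
  ... | negative = negativeFormula eq

  ~-isContext : ∀ {A} → Positive A ⊎ IsLiteral A → IsContextFormula (~ A)
  ~-isContext {A} (inj₁ A⁺)            = negativeFormula (trans (~-pol A) (opp-positive A⁺))
  ~-isContext     (inj₂ (isLiteral l)) = litIsContext (~ˡ l)

  posLit : (p : Literal 0) → p ∈𝒫 → ContextFormula
  posLit p p⁺ = lit p ,ʳ [ positiveLiteral p⁺ ]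

  dual : (A : Formula 0) → Positive A ⊎ IsLiteral A → ContextFormula
  dual A h = ~ A ,ʳ [ ~-isContext h ]

  -- Finite sets of literals are lists up to having the same elements.
  record Procedure : Set₁ where
    field
      T             : List (Literal 0) → Set
      extensional   : ∀ {S S′} → S ∼[ set ] S′ → T S → T S′
      weakening     : ∀ {S} S′ → T S → T (S ++ S′)
      contraction   : ∀ {S l} → T (l ∷ l ∷ S) → T (l ∷ S)
      instantiation : ∀ {S} x t → T S → T (map (substˡ x t) S)
      consistency   : ∀ {S p} → p ∈𝒫 → T (p ∷ S) → T (~ˡ p ∷ S) → T S

  module LK (𝒯 : Procedure) where
    open Procedure 𝒯 public using (T)

    infix 3 _⊢[_] _⊢_

    mutual
      data _⊢[_] : Context → Formula 0 → Set where
        ∧⁺-rule  : ∀ {Γ A B} → Γ ⊢[ A ] → Γ ⊢[ B ] → Γ ⊢[ A ∧⁺ B ]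
        ∨⁺-rule₁ : ∀ {Γ A B} → Γ ⊢[ A ] → Γ ⊢[ A ∨⁺ B ]
        ∨⁺-rule₂ : ∀ {Γ A B} → Γ ⊢[ B ] → Γ ⊢[ A ∨⁺ B ]
        ∃-rule   : ∀ {Γ A} t → Γ ⊢[ A ⟨ t ⟩ ] → Γ ⊢[ ∃′ A ]
        axiom    : ∀ {Γ p} (p⁺ : p ∈𝒫) → posLit p p⁺ ∷ Γ ⊢[ lit p ]
        T-axiom  : ∀ {Γ p} → p ∈𝒫 → T (~ˡ p ∷ Γ ˡⁱᵗ) → Γ ⊢[ lit p ]
        release  : ∀ {Γ N} → Negative N → Γ ⊢ N ∷ [] → Γ ⊢[ N ]
        exchangeᶠ : ∀ {Γ Γ′ A} → Γ ↭ Γ′ → Γ ⊢[ A ] → Γ′ ⊢[ A ]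

      data _⊢_ : Context → List (Formula 0) → Set where
        ∧⁻-rule : ∀ {Γ A B Δ} → Γ ⊢ A ∷ Δ → Γ ⊢ B ∷ Δ → Γ ⊢ A ∧⁻ B ∷ Δ
        ∨⁻-rule : ∀ {Γ A B Δ} → Γ ⊢ A ∷ B ∷ Δ → Γ ⊢ A ∨⁻ B ∷ Δ
        -- x ∉ fv A holds because x is the bound variable of ∀xA, whose
        -- nameless body A no longer mentions it.
        ∀-rule  : ∀ {Γ A Δ} x → All (λ C → x ∉ fv (value C)) Γ → All (λ C → x ∉ fv C) Δ →
                  x ∉ fv A → Γ ⊢ A ⟨ fvar x ⟩ ∷ Δ → Γ ⊢ ∀′ A ∷ Δ
        store   : ∀ {Γ A Δ} (h : Positive A ⊎ IsLiteral A) → dual A h ∷ Γ ⊢ Δ → Γ ⊢ A ∷ Δ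
        select  : ∀ {Γ P} (P⁺ : Positive P) →
                  dual P (inj₁ P⁺) ∷ Γ ⊢[ P ] → dual P (inj₁ P⁺) ∷ Γ ⊢ []
        T-close : ∀ {Γ} → T (Γ ˡⁱᵗ) → Γ ⊢ []
        exchange : ∀ {Γ Γ′ Δ Δ′} → Γ ↭ Γ′ → Δ ↭ Δ′ → Γ ⊢ Δ → Γ′ ⊢ Δ′

{-# OPTIONS --safe #-}

-- A derivation that uses p only needs it where T is consulted, in an axiom on
-- p, or as the dual of a selected formula.  Consistency removes p from calls
-- to T, an axiom on p becomes a T-axiom by the hypothesis on p, and a selected
-- formula has a negative dual, which is never p.  The hypothesis on p survives
-- every extension of the context by weakening of T.

module Submission where

open import Data.List using (List; _∷_; _++_)
open import Data.List.Membership.Propositional.Properties using (∈-++⁻; ∈-++⁺ʳ; ∈-∃++)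
open import Data.List.Relation.Binary.Permutation.Propositional using (_↭_; prep; swap; ↭-refl; ↭-sym; ↭-trans; ↭-reflexive)
open import Data.List.Relation.Binary.Permutation.Propositional.Properties using (All-resp-↭; ∈-resp-↭; mapMaybe-↭; shift)
open import Data.List.Relation.Binary.Subset.Propositional using (_⊆_)
open import Data.List.Relation.Binary.Subset.Propositional.Properties using (∷⁺ʳ)
open import Data.List.Relation.Unary.All as All using ()
open import Data.List.Relation.Unary.Any using (here; there)
open import Data.Maybe using (just; nothing)
open import Data.Product using (_×_; _,_; ∃-syntax)
open import Data.Refinement using (value)
open import Data.Sum using (_⊎_; inj₁; inj₂; [_,_]′)
open import Function using (_∘_; id; mk⇔)
open import Relation.Binary.PropositionalEquality using (_≡_; _≢_; refl; sym; trans; cong)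
open import Relation.Nullary using (contradiction)
open import Defs

-- The head `x` is either `y` or occurs in `ys`, where `shift` brings it to the front. This locates
-- the principal formula of `axiom` and `select` relative to the cut literal.
∷-↭-∷⁻ : ∀ {a} {A : Set a} {x y : A} {xs ys} →
         x ∷ xs ↭ y ∷ ys → x ≡ y ⊎ ∃[ zs ] ys ↭ x ∷ zs
∷-↭-∷⁻ {x = x} π with ∈-resp-↭ π (here refl)
... | here x≡y   = inj₁ x≡y
... | there x∈ys with us , vs , eq ← ∈-∃++ x∈ys =
  inj₂ (us ++ vs , ↭-trans (↭-reflexive eq) (shift x us vs))

module _ {Sig : Signature} where
  open Syntax Sig

  ˡⁱᵗ-⊆-∷ : ∀ C Γ → Γ ˡⁱᵗ ⊆ (C ∷ Γ) ˡⁱᵗ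
  ˡⁱᵗ-⊆-∷ C Γ with asLiteral (value C)
  ... | just _  = there
  ... | nothing = id

  ˡⁱᵗ-resp-↭ : ∀ {Γ Γ′} → Γ ↭ Γ′ → Γ ˡⁱᵗ ↭ Γ′ ˡⁱᵗ
  ˡⁱᵗ-resp-↭ = mapMaybe-↭ (asLiteral ∘ value)

  dual≢posLit : ∀ {P p} (P⁺ : Positive P) (p⁺ : p ∈𝒫) → dual P (inj₁ P⁺) ≢ posLit p p⁺
  dual≢posLit {P} P⁺ p⁺ eq
    with () ← trans (sym p⁺)
                (trans (cong (polarity ∘ value) (sym eq))
                  (trans (~-pol P) (opp-positive P⁺)))

  module _ (𝒯 : Procedure) where
    open Procedure 𝒯 using (extensional; weakening; consistency)
    open LK 𝒯

    -- When `S ⊆ S′`, the list `S ++ S′` has the same elements as `S′`, so weakening by `S′`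
    -- suffices.
    T-mono : ∀ {S S′} → S ⊆ S′ → T S → T S′
    T-mono {S} {S′} S⊆S′ =
      extensional (mk⇔ ([ S⊆S′ , id ]′ ∘ ∈-++⁻ S) (∈-++⁺ʳ S)) ∘ weakening S′

    T-resp-↭ : ∀ {S S′} → S ↭ S′ → T S → T S′
    T-resp-↭ π = T-mono (∈-resp-↭ π)

    module _ {p : Literal 0} (p⁺ : p ∈𝒫) where

      mutual
        -- Exchange can move `p` anywhere, so the context is fixed only up to a permutation `π`.
        -- Exchanges compose into `π`, and the induction stays structural on the derivation.
        cut₁ : ∀ {Γ Γ′ Δ} → Γ′ ↭ posLit p p⁺ ∷ Γ → T (~ˡ p ∷ Γ ˡⁱᵗ) → Γ′ ⊢ Δ → Γ ⊢ Δ
        cut₁ π τ (∧⁻-rule d e) = ∧⁻-rule (cut₁ π τ d) (cut₁ π τ e)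
        cut₁ π τ (∨⁻-rule d)   = ∨⁻-rule (cut₁ π τ d)
        cut₁ π τ (∀-rule x x∉Γ x∉Δ x∉A d) =
          ∀-rule x (All.tail (All-resp-↭ π x∉Γ)) x∉Δ x∉A (cut₁ π τ d)
        -- The stored formula may be a literal and enlarge the set given to `T`, so `τ` is weakened
        -- along with the context.
        cut₁ {Γ} π τ (store {A = A} h d) =
          store h (cut₁ (↭-trans (prep _ π) (swap _ _ ↭-refl))
                        (T-mono (∷⁺ʳ _ (ˡⁱᵗ-⊆-∷ (dual A h) Γ)) τ) d)
        cut₁ π τ (select P⁺ d) with ∷-↭-∷⁻ π
        ... | inj₁ eq      = contradiction eq (dual≢posLit P⁺ p⁺)
        ... | inj₂ (_ , ρ) =
          -- The dual of `P` survives in `Γ`; `ρ` moves it to the front for `select`, and its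
          -- inverse restores `Γ`.
          exchange (↭-sym ρ) ↭-refl (select P⁺ (exchangeᶠ ρ (cut₂ π τ d)))
        cut₁ π τ (T-close t) = T-close (consistency p⁺ (T-resp-↭ (ˡⁱᵗ-resp-↭ π) t) τ)
        cut₁ π τ (exchange ρ δ d) = exchange ↭-refl δ (cut₁ (↭-trans ρ π) τ d)

        cut₂ : ∀ {Γ Γ′ B} → Γ′ ↭ posLit p p⁺ ∷ Γ → T (~ˡ p ∷ Γ ˡⁱᵗ) → Γ′ ⊢[ B ] → Γ ⊢[ B ]
        cut₂ π τ (∧⁺-rule d e) = ∧⁺-rule (cut₂ π τ d) (cut₂ π τ e)
        cut₂ π τ (∨⁺-rule₁ d)  = ∨⁺-rule₁ (cut₂ π τ d)
        cut₂ π τ (∨⁺-rule₂ d)  = ∨⁺-rule₂ (cut₂ π τ d)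
        cut₂ π τ (∃-rule t d)  = ∃-rule t (cut₂ π τ d)
        cut₂ π τ (axiom q⁺) with ∷-↭-∷⁻ π
        ... | inj₁ eq with refl ← cong value eq = T-axiom p⁺ τ
        ... | inj₂ (_ , ρ) = exchangeᶠ (↭-sym ρ) (axiom q⁺)
        -- Consistency is applied over the literals of `Γ` with the negation of the focused literal
        -- added, so `τ` is weakened by that negation.
        cut₂ π τ (T-axiom q⁺ t) =
          T-axiom q⁺ (consistency p⁺
            (T-resp-↭ (↭-trans (prep _ (ˡⁱᵗ-resp-↭ π)) (swap _ _ ↭-refl)) t)
            (T-mono (∷⁺ʳ _ there) τ))
        cut₂ π τ (release N⁻ d)  = release N⁻ (cut₁ π τ d)
        cut₂ π τ (exchangeᶠ ρ d) = cut₂ (↭-trans ρ π) τ d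

mainTheorem4 : (Sig : Signature) → let open Syntax Sig in
    (𝒯 : Procedure) → let open LK 𝒯 in
    (Γ : Context) (p : Literal 0) (p⁺ : p ∈𝒫) (B : Formula 0) (Δ : List (Formula 0)) →
    T (~ˡ p ∷ Γ ˡⁱᵗ) →
    (posLit p p⁺ ∷ Γ ⊢ Δ → Γ ⊢ Δ) × (posLit p p⁺ ∷ Γ ⊢[ B ] → Γ ⊢[ B ])
mainTheorem4 Sig 𝒯 Γ p p⁺ B Δ τ = cut₁ 𝒯 p⁺ ↭-refl τ , cut₂ 𝒯 p⁺ ↭-refl τ
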